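{- Let $p$ be an odd prime such that $(p,p)$ is hyperbolic, i.e. $1/p+1/p<1/2$. Then the regular map of type $(p,p)$ given by the generating triple $(X,Y,Z)$ of matrices described in the context is self-dual.
   Context: A regular map of type $(k,l)$ (vertex degree $k$, face length $l$) is identified with a group $G$ generated by three involutions $X,Y,Z$ such that $XY$, $YZ$, $ZX$ have orders exactly $2,k,l$ respectively. The map is self-dual if $G$ has an (involutory) automorphism fixing $Z$ and interchanging $X$ and $Y$. The maps considered have $G$ isomorphic to $PSL(2,q)$ or $PGL(2,q)$ with $q$ a power of the odd prime $p$. Matrices are regarded up to nonzero scalar multiples, i.e. as elements of $PGL(2,K)$ with $K$ an algebraic closure of $GF(p)$. For type $(p,p)$ the generating triple is, with $\alpha^2=-1$, $$X=-\alpha\begin{pmatrix}1&0\\2&-1\end{pmatrix},\quad Y=-\alpha\begin{pmatrix}1&-1\\0&-1\end{pmatrix},\quad Z=\alpha\begin{pmatrix}1&0\\0&-1\end{pmatrix}.$$ -}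

module Defs where

open import Level using (Level; _⊔_) renaming (suc to lsuc)
open import Algebra.Bundles using (CommutativeRing; Group)
open import Algebra.Morphism.Structures using (module GroupMorphisms)
import Algebra.Definitions
import Algebra.Definitions.RawMonoid
import Algebra.Properties.Ring
import Algebra.Solver.Ring.NaturalCoefficients.Default
open import Data.Fin.Base using (Fin; zero; suc)
open import Data.Integer.Base using (+_)
open import Data.List.Base using (List; []; _∷_; map)
open import Data.Nat.Base using (ℕ; zero; suc; NonZero; _<_; z≤n; s≤s; >-nonZero⁻¹; nonTrivial⇒n>1)
open import Data.Nat.Divisibility using (_∣_; ∣-refl; ∣⇒≤)
open import Data.Nat.Primality using (Prime; prime⇒nonTrivial; prime⇒nonZero)
import Data.Nat.Properties as ℕ
open import Data.Product.Base using (Σ; ∃-syntax; _×_; _,_; proj₁; proj₂)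
import Data.Rational.Base as ℚ
open import Data.Sum.Base using (_⊎_; inj₁; inj₂)
import Data.Vec.Functional as Vector
open import Function.Bundles using (_⇔_; module Equivalence)
open import Relation.Binary.PropositionalEquality.Core using (refl)
import Relation.Binary.Reasoning.Setoid
open import Relation.Nullary using (¬_)
open import Data.Empty using (⊥-elim)

module _ {c ℓ} (G : Group c ℓ) where
  open Group G
  open Algebra.Definitions.RawMonoid rawMonoid using () renaming (_×_ to _times_)

  infixr 8 _^_

  _^_ : Carrier → ℕ → Carrier
  x ^ n = n times x

  record HasOrder (n : ℕ) (x : Carrier) : Set ℓ where
    field
      positive : 0 < n
      power    : x ^ n ≈ ε
      minimal  : ∀ m → 0 < m → m < n → ¬ (x ^ m ≈ ε)

  data Generated {I : Set} (S : I → Carrier) : Carrier → Set (c ⊔ ℓ) where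
    gen     : ∀ i → Generated S (S i)
    gen-ε   : Generated S ε
    gen-∙   : ∀ {x y} → Generated S x → Generated S y → Generated S (x ∙ y)
    gen-⁻¹  : ∀ {x} → Generated S x → Generated S (x ⁻¹)
    gen-≈   : ∀ {x y} → x ≈ y → Generated S x → Generated S y

  triple : Carrier → Carrier → Carrier → Fin 3 → Carrier
  triple x y z = x Vector.∷ y Vector.∷ z Vector.∷ Vector.[]

  generatedSubgroup : {I : Set} (S : I → Carrier) → Group (c ⊔ ℓ) ℓ
  generatedSubgroup S = record
    { Carrier = Σ Carrier (Generated S)
    ; _≈_     = λ g h → proj₁ g ≈ proj₁ h
    ; _∙_     = λ (x , s) (y , t) → x ∙ y , gen-∙ s t
    ; ε       = ε , gen-ε
    ; _⁻¹     = λ (x , s) → x ⁻¹ , gen-⁻¹ s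
    ; isGroup = record
      { isMonoid = record
        { isSemigroup = record
          { isMagma = record
            { isEquivalence = record { refl = Group.refl G ; sym = sym ; trans = trans }
            ; ∙-cong = ∙-cong
            }
          ; assoc = λ x y z → assoc (proj₁ x) (proj₁ y) (proj₁ z)
          }
        ; identity = (λ x → identityˡ (proj₁ x)) , (λ x → identityʳ (proj₁ x))
        }
      ; inverse = (λ x → inverseˡ (proj₁ x)) , (λ x → inverseʳ (proj₁ x))
      ; ⁻¹-cong = ⁻¹-cong
      }
    }

-- A map of vertex degree k and face length l is identified with the group
-- generated by the three reflections in the sides of a flag.
record RegularMap (c ℓ : Level) (k l : ℕ) : Set (lsuc (c ⊔ ℓ)) where
  field
    group : Group c ℓ
  open Group group
  field
    X Y Z      : Carrier
    generates  : ∀ g → Generated group (triple group X Y Z) g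
    X-order    : HasOrder group 2 X
    Y-order    : HasOrder group 2 Y
    Z-order    : HasOrder group 2 Z
    XY-order   : HasOrder group 2 (X ∙ Y)
    YZ-order   : HasOrder group k (Y ∙ Z)
    ZX-order   : HasOrder group l (Z ∙ X)

module _ {c ℓ} (G : Group c ℓ) where
  open Group G

  generatedMap : ∀ {k l} (X Y Z : Carrier) →
    HasOrder G 2 X → HasOrder G 2 Y → HasOrder G 2 Z →
    HasOrder G 2 (X ∙ Y) → HasOrder G k (Y ∙ Z) → HasOrder G l (Z ∙ X) →
    RegularMap (c ⊔ ℓ) ℓ k l
  generatedMap X Y Z oX oY oZ oXY oYZ oZX = record
    { group     = H
    ; X         = x
    ; Y         = y
    ; Z         = z
    ; generates = λ (_ , s) → generated s
    ; X-order   = restrict x oX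
    ; Y-order   = restrict y oY
    ; Z-order   = restrict z oZ
    ; XY-order  = restrict _ oXY
    ; YZ-order  = restrict _ oYZ
    ; ZX-order  = restrict _ oZX
    }
    where
    S : Fin 3 → Carrier
    S = triple G X Y Z

    H : Group (c ⊔ ℓ) ℓ
    H = generatedSubgroup G S

    x y z : Group.Carrier H
    x = X , gen zero
    y = Y , gen (suc zero)
    z = Z , gen (suc (suc zero))

    generated : ∀ {g} (s : Generated G S g) → Generated H (triple H x y z) (g , s)
    generated (gen zero)             = gen zero
    generated (gen (suc zero))       = gen (suc zero)
    generated (gen (suc (suc zero))) = gen (suc (suc zero))
    generated gen-ε                  = gen-ε
    generated (gen-∙ s t)            = gen-∙ (generated s) (generated t)
    generated (gen-⁻¹ s)             = gen-⁻¹ (generated s)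
    generated (gen-≈ e s)            = gen-≈ e (generated s)

    power-proj₁ : ∀ g m → proj₁ (_^_ H g m) ≈ _^_ G (proj₁ g) m
    power-proj₁ g zero    = Group.refl G
    power-proj₁ g (suc m) = ∙-congˡ (power-proj₁ g m)

    restrict : ∀ {n} g → HasOrder G n (proj₁ g) → HasOrder H n g
    restrict {n} g o = record
      { positive = HasOrder.positive o
      ; power    = trans (power-proj₁ g n) (HasOrder.power o)
      ; minimal  = λ m m>0 m<n e →
          HasOrder.minimal o m m>0 m<n (trans (sym (power-proj₁ g m)) e)
      }

record SelfDual {c ℓ k l} (M : RegularMap c ℓ k l) : Set (c ⊔ ℓ) where
  open RegularMap M
  open Group group
  open GroupMorphisms rawGroup rawGroup using (IsGroupIsomorphism)
  field
    φ              : Carrier → Carrier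
    isAutomorphism : IsGroupIsomorphism φ
    involutory     : ∀ g → φ (φ g) ≈ g
    fixes-Z        : φ Z ≈ Z
    X↦Y            : φ X ≈ Y
    Y↦X            : φ Y ≈ X

Hyperbolic : (k l : ℕ) .{{_ : NonZero k}} .{{_ : NonZero l}} → Set
Hyperbolic k l = (+ 1 ℚ./ k) ℚ.+ (+ 1 ℚ./ l) ℚ.< ℚ.½

-- Discrete fields: it is decidable whether an element is zero.  This is no
-- restriction here, since an algebraic closure of GF(p) is a union of finite
-- fields.
record Field (c ℓ : Level) : Set (lsuc (c ⊔ ℓ)) where
  field
    commutativeRing : CommutativeRing c ℓ
  open CommutativeRing commutativeRing public
  open Algebra.Definitions _≈_ using (Invertible)
  field
    1≉0           : ¬ (1# ≈ 0#)
    0⊎invertible  : ∀ x → (x ≈ 0#) ⊎ Invertible 1# _*_ x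

module _ {c ℓ} (K : Field c ℓ) where
  open Field K
  open Algebra.Definitions.RawMonoid +-rawMonoid using () renaming (_×_ to _times_)

  natural : ℕ → Carrier
  natural n = n times 1#

  -- For as = a₀ , … , aₙ₋₁ this is  a₀ + a₁ x + … + aₙ₋₁ xⁿ⁻¹ + xⁿ.
  evalMonic : List Carrier → Carrier → Carrier
  evalMonic []       x = 1#
  evalMonic (a ∷ as) x = a + x * evalMonic as x

  -- By the first field, for p prime, the elements natural n make up the copy of
  -- GF(p) in K, so lists of naturals give all monic polynomials over GF(p).
  record IsAlgebraicClosureOfGF (p : ℕ) : Set (c ⊔ ℓ) where
    field
      characteristic       : ∀ n → (natural n ≈ 0#) ⇔ (p ∣ n)
      algebraic            : ∀ x → ∃[ ns ] (evalMonic (map natural ns) x ≈ 0#)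
      algebraically-closed : ∀ a as → ∃[ x ] (evalMonic (a ∷ as) x ≈ 0#)

module Projective {c ℓ} (K : Field c ℓ) where
  open Field K hiding (zero) renaming (refl to ≈-refl; sym to ≈-sym; trans to ≈-trans)
  open Algebra.Solver.Ring.NaturalCoefficients.Default commutativeSemiring
    using (solve; _:=_; _:+_; _:*_; con)

  record Matrix : Set c where
    constructor matrix
    field
      e₁₁ e₁₂ e₂₁ e₂₂ : Carrier
  open Matrix public

  infix  4 _≈ₘ_ _∼_
  infixl 7 _*ₘ_
  infixr 8 _•_

  record _≈ₘ_ (M N : Matrix) : Set ℓ where
    constructor entries
    field
      eq₁₁ : e₁₁ M ≈ e₁₁ N
      eq₁₂ : e₁₂ M ≈ e₁₂ N
      eq₂₁ : e₂₁ M ≈ e₂₁ N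
      eq₂₂ : e₂₂ M ≈ e₂₂ N
  open _≈ₘ_ public

  _*ₘ_ : Matrix → Matrix → Matrix
  matrix a b c d *ₘ matrix e f g h =
    matrix (a * e + b * g) (a * f + b * h) (c * e + d * g) (c * f + d * h)

  1ₘ : Matrix
  1ₘ = matrix 1# 0# 0# 1#

  _•_ : Carrier → Matrix → Matrix
  s • matrix a b c d = matrix (s * a) (s * b) (s * c) (s * d)

  _∼_ : Matrix → Matrix → Set (c ⊔ ℓ)
  M ∼ N = ∃[ s ] (¬ (s ≈ 0#) × M ≈ₘ s • N)

  open Algebra.Definitions _≈ₘ_ using (Invertible)

  GL₂ : Set (c ⊔ ℓ)
  GL₂ = Σ Matrix (Invertible 1ₘ _*ₘ_)

  ≈ₘ-refl : ∀ {M} → M ≈ₘ M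
  ≈ₘ-refl = entries ≈-refl ≈-refl ≈-refl ≈-refl

  ≈ₘ-sym : ∀ {M N} → M ≈ₘ N → N ≈ₘ M
  ≈ₘ-sym (entries p q r s) = entries (≈-sym p) (≈-sym q) (≈-sym r) (≈-sym s)

  ≈ₘ-trans : ∀ {M N O} → M ≈ₘ N → N ≈ₘ O → M ≈ₘ O
  ≈ₘ-trans (entries p q r s) (entries p′ q′ r′ s′) =
    entries (≈-trans p p′) (≈-trans q q′) (≈-trans r r′) (≈-trans s s′)

  *ₘ-cong : ∀ {M M′ N N′} → M ≈ₘ M′ → N ≈ₘ N′ → M *ₘ N ≈ₘ M′ *ₘ N′
  *ₘ-cong (entries p q r s) (entries p′ q′ r′ s′) = entries
    (+-cong (*-cong p p′) (*-cong q r′)) (+-cong (*-cong p q′) (*-cong q s′))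
    (+-cong (*-cong r p′) (*-cong s r′)) (+-cong (*-cong r q′) (*-cong s s′))

  *ₘ-assoc : ∀ M N O → (M *ₘ N) *ₘ O ≈ₘ M *ₘ (N *ₘ O)
  *ₘ-assoc (matrix a b c d) (matrix e f g h) (matrix i j k l) =
    entries (entry a b i k) (entry a b j l) (entry c d i k) (entry c d j l)
    where
    entry : ∀ a b i k →
      (a * e + b * g) * i + (a * f + b * h) * k ≈ a * (e * i + f * k) + b * (g * i + h * k)
    entry a b i k = solve 8 (λ a b e f g h i k →
      (a :* e :+ b :* g) :* i :+ (a :* f :+ b :* h) :* k
        := a :* (e :* i :+ f :* k) :+ b :* (g :* i :+ h :* k))
      ≈-refl a b e f g h i k

  *ₘ-identityˡ : ∀ M → 1ₘ *ₘ M ≈ₘ M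
  *ₘ-identityˡ (matrix a b c d) = entries (first a c) (first b d) (second a c) (second b d)
    where
    first : ∀ x y → 1# * x + 0# * y ≈ x
    first x y = ≈-trans (+-cong (*-identityˡ x) (zeroˡ y)) (+-identityʳ x)
    second : ∀ x y → 0# * x + 1# * y ≈ y
    second x y = ≈-trans (+-cong (zeroˡ x) (*-identityˡ y)) (+-identityˡ y)

  *ₘ-identityʳ : ∀ M → M *ₘ 1ₘ ≈ₘ M
  *ₘ-identityʳ (matrix a b c d) = entries (first a b) (second a b) (first c d) (second c d)
    where
    first : ∀ x y → x * 1# + y * 0# ≈ x
    first x y = ≈-trans (+-cong (*-identityʳ x) (zeroʳ y)) (+-identityʳ x)
    second : ∀ x y → x * 0# + y * 1# ≈ y
    second x y = ≈-trans (+-cong (zeroʳ x) (*-identityʳ y)) (+-identityˡ y)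

  •-cong : ∀ {s t M N} → s ≈ t → M ≈ₘ N → s • M ≈ₘ t • N
  •-cong e (entries p q r s) = entries (*-cong e p) (*-cong e q) (*-cong e r) (*-cong e s)

  •-• : ∀ s t M → s • (t • M) ≈ₘ (s * t) • M
  •-• s t M = entries (a _) (a _) (a _) (a _)
    where
    a : ∀ x → s * (t * x) ≈ s * t * x
    a x = ≈-sym (*-assoc s t x)

  1• : ∀ M → 1# • M ≈ₘ M
  1• M = entries (*-identityˡ _) (*-identityˡ _) (*-identityˡ _) (*-identityˡ _)

  •-*ₘ : ∀ s t M N → (s • M) *ₘ (t • N) ≈ₘ (s * t) • (M *ₘ N)
  •-*ₘ s t (matrix a b c d) (matrix e f g h) =
    entries (entry a b e g) (entry a b f h) (entry c d e g) (entry c d f h)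
    where
    entry : ∀ a b e g → s * a * (t * e) + s * b * (t * g) ≈ s * t * (a * e + b * g)
    entry a b e g = solve 6 (λ s t a b e g →
      s :* a :* (t :* e) :+ s :* b :* (t :* g) := s :* t :* (a :* e :+ b :* g))
      ≈-refl s t a b e g

  reciprocal : ∀ {x} → ¬ (x ≈ 0#) → ∃[ y ] (y * x ≈ 1#)
  reciprocal {x} x≉0 with 0⊎invertible x
  ... | inj₁ x≈0            = ⊥-elim (x≉0 x≈0)
  ... | inj₂ (y , yx≈1 , _) = y , yx≈1

  leftFactor≉0 : ∀ {x y} → y * x ≈ 1# → ¬ (y ≈ 0#)
  leftFactor≉0 yx≈1 y≈0 =
    1≉0 (≈-trans (≈-sym yx≈1) (≈-trans (*-congʳ y≈0) (zeroˡ _)))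

  cancelʳ : ∀ {x y} → ¬ (y ≈ 0#) → x * y ≈ 0# → x ≈ 0#
  cancelʳ {x} {y} y≉0 xy≈0 with reciprocal y≉0
  ... | z , zy≈1 = begin
    x           ≈⟨ *-identityˡ x ⟨
    1# * x      ≈⟨ *-congʳ zy≈1 ⟨
    z * y * x   ≈⟨ *-assoc z y x ⟩
    z * (y * x) ≈⟨ *-congˡ (*-comm y x) ⟩
    z * (x * y) ≈⟨ *-congˡ xy≈0 ⟩
    z * 0#      ≈⟨ zeroʳ z ⟩
    0#          ∎
    where open Relation.Binary.Reasoning.Setoid setoid

  ≈⇒∼ : ∀ {M N} → M ≈ₘ N → M ∼ N
  ≈⇒∼ e = 1# , 1≉0 , ≈ₘ-trans e (≈ₘ-sym (1• _))

  •∼ : ∀ {s} M → ¬ (s ≈ 0#) → s • M ∼ M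
  •∼ {s} M s≉0 = s , s≉0 , ≈ₘ-refl

  ∼-refl : ∀ {M} → M ∼ M
  ∼-refl = ≈⇒∼ ≈ₘ-refl

  ∼-sym : ∀ {M N} → M ∼ N → N ∼ M
  ∼-sym {M} {N} (s , s≉0 , e) with reciprocal s≉0
  ... | t , ts≈1 = t , leftFactor≉0 ts≈1 ,
    ≈ₘ-sym (≈ₘ-trans (•-cong ≈-refl e)
      (≈ₘ-trans (•-• t s N) (≈ₘ-trans (•-cong ts≈1 ≈ₘ-refl) (1• N))))

  ∼-trans : ∀ {M N O} → M ∼ N → N ∼ O → M ∼ O
  ∼-trans (s , s≉0 , e) (t , t≉0 , f) =
    s * t , (λ st≈0 → s≉0 (cancelʳ t≉0 st≈0)) ,
    ≈ₘ-trans e (≈ₘ-trans (•-cong ≈-refl f) (•-• s t _))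

  ∼-cong : ∀ {M M′ N N′} → M ∼ M′ → N ∼ N′ → M *ₘ N ∼ M′ *ₘ N′
  ∼-cong (s , s≉0 , e) (t , t≉0 , f) =
    s * t , (λ st≈0 → s≉0 (cancelʳ t≉0 st≈0)) ,
    ≈ₘ-trans (*ₘ-cong e f) (•-*ₘ s t _ _)

  insertInverse : ∀ {M M′ N} → M *ₘ M′ ≈ₘ 1ₘ → M *ₘ (M′ *ₘ N) ≈ₘ N
  insertInverse {M} {M′} {N} e =
    ≈ₘ-trans (≈ₘ-sym (*ₘ-assoc M M′ N)) (≈ₘ-trans (*ₘ-cong e ≈ₘ-refl) (*ₘ-identityˡ N))

  product-inverse : ∀ {M M′ N N′} → M *ₘ M′ ≈ₘ 1ₘ → N *ₘ N′ ≈ₘ 1ₘ →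
                    (M *ₘ N) *ₘ (N′ *ₘ M′) ≈ₘ 1ₘ
  product-inverse {M} {M′} {N} {N′} e f =
    ≈ₘ-trans (*ₘ-assoc M N (N′ *ₘ M′)) (≈ₘ-trans (*ₘ-cong ≈ₘ-refl (insertInverse f)) e)

  PGL₂ : Group (c ⊔ ℓ) (c ⊔ ℓ)
  PGL₂ = record
    { Carrier = GL₂
    ; _≈_     = λ g h → proj₁ g ∼ proj₁ h
    ; _∙_     = λ (M , M′ , l , r) (N , N′ , l′ , r′) →
                  M *ₘ N , N′ *ₘ M′ , product-inverse l′ l , product-inverse r r′
    ; ε       = 1ₘ , 1ₘ , *ₘ-identityˡ 1ₘ , *ₘ-identityˡ 1ₘ
    ; _⁻¹     = λ (M , M′ , l , r) → M′ , M , r , l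
    ; isGroup = record
      { isMonoid = record
        { isSemigroup = record
          { isMagma = record
            { isEquivalence = record { refl = ∼-refl ; sym = ∼-sym ; trans = ∼-trans }
            ; ∙-cong = ∼-cong
            }
          ; assoc = λ g h k → ≈⇒∼ (*ₘ-assoc (proj₁ g) (proj₁ h) (proj₁ k))
          }
        ; identity = (λ g → ≈⇒∼ (*ₘ-identityˡ (proj₁ g))) , (λ g → ≈⇒∼ (*ₘ-identityʳ (proj₁ g)))
        }
      ; inverse = (λ (_ , _ , l , _) → ≈⇒∼ l) , (λ (_ , _ , _ , r) → ≈⇒∼ r)
      ; ⁻¹-cong = λ { {M , M′ , l , r} {N , N′ , l′ , r′} M∼N →
          ∼-trans (≈⇒∼ (≈ₘ-sym (*ₘ-identityʳ M′)))
            (∼-trans (∼-cong ∼-refl (≈⇒∼ (≈ₘ-sym r′)))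
              (∼-trans (∼-cong ∼-refl (∼-cong (∼-sym M∼N) ∼-refl))
                (≈⇒∼ (insertInverse l)))) }
      }
    }

module _ {c ℓ} (K : Field c ℓ) where
  open Field K hiding (zero) renaming (refl to ≈-refl; sym to ≈-sym; trans to ≈-trans)
  open Projective K
  open Algebra.Properties.Ring ring
    using (-‿distribˡ-*; -‿distribʳ-*; -‿involutive; -1*x≈-x; -‿injective; -0#≈0#)
  open Algebra.Solver.Ring.NaturalCoefficients.Default commutativeSemiring
    using (solve; _:=_; _:+_; _:*_; con)

  2# : Carrier
  2# = 1# + 1#

  X₀ Y₀ Z₀ : Matrix
  X₀ = matrix 1# 0#     2# (- 1#)
  Y₀ = matrix 1# (- 1#) 0# (- 1#)
  Z₀ = matrix 1# 0#     0# (- 1#)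

  -1² : - 1# * - 1# ≈ 1#
  -1² = ≈-trans (-1*x≈-x (- 1#)) (-‿involutive 1#)

  -1≉0 : ¬ (- 1# ≈ 0#)
  -1≉0 e = 1≉0 (-‿injective (≈-trans e (≈-sym -0#≈0#)))

  -- Entries are handled by the semiring solver with n standing for - 1#.
  module _ (n : Carrier) (1+n : 1# + n ≈ 0#) (n² : n * n ≈ 1#) where

    private
      A B C : Matrix
      A = matrix 1# 0# 2# n
      B = matrix 1# n  0# n
      C = matrix 1# 0# 0# n

      collect : ∀ {x} y → x ≈ y * (1# + n) → x ≈ 0#
      collect y e = ≈-trans e (≈-trans (*-congˡ 1+n) (zeroʳ y))

    A² : A *ₘ A ≈ₘ 1ₘ
    A² = entries
      (solve 0 (con 1 :* con 1 :+ con 0 :* (con 1 :+ con 1) := con 1) ≈-refl)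
      (solve 1 (λ n → con 1 :* con 0 :+ con 0 :* n := con 0) ≈-refl n)
      (collect 2# (solve 1 (λ n → (con 1 :+ con 1) :* con 1 :+ n :* (con 1 :+ con 1)
                                  := (con 1 :+ con 1) :* (con 1 :+ n)) ≈-refl n))
      (≈-trans (solve 1 (λ n → (con 1 :+ con 1) :* con 0 :+ n :* n := n :* n) ≈-refl n) n²)

    B² : B *ₘ B ≈ₘ 1ₘ
    B² = entries
      (solve 1 (λ n → con 1 :* con 1 :+ n :* con 0 := con 1) ≈-refl n)
      (collect n (solve 1 (λ n → con 1 :* n :+ n :* n := n :* (con 1 :+ n)) ≈-refl n))
      (solve 1 (λ n → con 0 :* con 1 :+ n :* con 0 := con 0) ≈-refl n)
      (≈-trans (solve 1 (λ n → con 0 :* n :+ n :* n := n :* n) ≈-refl n) n²)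

    C² : C *ₘ C ≈ₘ 1ₘ
    C² = entries
      (solve 0 (con 1 :* con 1 :+ con 0 :* con 0 := con 1) ≈-refl)
      (solve 1 (λ n → con 1 :* con 0 :+ con 0 :* n := con 0) ≈-refl n)
      (solve 1 (λ n → con 0 :* con 1 :+ n :* con 0 := con 0) ≈-refl n)
      (≈-trans (solve 1 (λ n → con 0 :* con 0 :+ n :* n := n :* n) ≈-refl n) n²)

    AB : A *ₘ B ≈ₘ matrix 1# n 2# n
    AB = entries
      (solve 0 (con 1 :* con 1 :+ con 0 :* con 0 := con 1) ≈-refl)
      (solve 1 (λ n → con 1 :* n :+ con 0 :* n := n) ≈-refl n)
      (solve 1 (λ n → (con 1 :+ con 1) :* con 1 :+ n :* con 0 := con 1 :+ con 1) ≈-refl n)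
      (≈-trans (solve 1 (λ n → (con 1 :+ con 1) :* n :+ n :* n
                                := n :+ n :* (con 1 :+ n)) ≈-refl n)
        (≈-trans (+-congˡ (collect n ≈-refl)) (+-identityʳ n)))

    AB² : matrix 1# n 2# n *ₘ matrix 1# n 2# n ≈ₘ n • 1ₘ
    AB² = entries
      (≈-trans (solve 1 (λ n → con 1 :* con 1 :+ n :* (con 1 :+ con 1)
                                := n :* con 1 :+ (con 1 :+ n)) ≈-refl n)
        (≈-trans (+-congˡ 1+n) (+-identityʳ _)))
      (≈-trans (collect n (solve 1 (λ n → con 1 :* n :+ n :* n := n :* (con 1 :+ n)) ≈-refl n))
        (≈-sym (zeroʳ n)))
      (≈-trans (collect 2# (solve 1 (λ n → (con 1 :+ con 1) :* con 1 :+ n :* (con 1 :+ con 1)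
                                  := (con 1 :+ con 1) :* (con 1 :+ n)) ≈-refl n))
        (≈-sym (zeroʳ n)))
      (≈-trans (solve 1 (λ n → (con 1 :+ con 1) :* n :+ n :* n
                                := n :* con 1 :+ n :* (con 1 :+ n)) ≈-refl n)
        (≈-trans (+-congˡ (collect n ≈-refl)) (+-identityʳ _)))

    BC : B *ₘ C ≈ₘ matrix 1# 1# 0# 1#
    BC = entries
      (solve 1 (λ n → con 1 :* con 1 :+ n :* con 0 := con 1) ≈-refl n)
      (≈-trans (solve 1 (λ n → con 1 :* con 0 :+ n :* n := n :* n) ≈-refl n) n²)
      (solve 1 (λ n → con 0 :* con 1 :+ n :* con 0 := con 0) ≈-refl n)
      (≈-trans (solve 1 (λ n → con 0 :* con 0 :+ n :* n := n :* n) ≈-refl n) n²)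

    CA : C *ₘ A ≈ₘ matrix 1# 0# (n * 2#) 1#
    CA = entries
      (solve 0 (con 1 :* con 1 :+ con 0 :* (con 1 :+ con 1) := con 1) ≈-refl)
      (solve 1 (λ n → con 1 :* con 0 :+ con 0 :* n := con 0) ≈-refl n)
      (solve 1 (λ n → con 0 :* con 1 :+ n :* (con 1 :+ con 1) := n :* (con 1 :+ con 1)) ≈-refl n)
      (≈-trans (solve 1 (λ n → con 0 :* con 0 :+ n :* n := n :* n) ≈-refl n) n²)

  upper : ∀ x → matrix 1# 1# 0# 1# *ₘ matrix 1# x 0# 1# ≈ₘ matrix 1# (1# + x) 0# 1#
  upper x = entries
    (solve 0 (con 1 :* con 1 :+ con 1 :* con 0 := con 1) ≈-refl)
    (solve 1 (λ x → con 1 :* x :+ con 1 :* con 1 := con 1 :+ x) ≈-refl x)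
    (solve 0 (con 0 :* con 1 :+ con 1 :* con 0 := con 0) ≈-refl)
    (solve 1 (λ x → con 0 :* x :+ con 1 :* con 1 := con 1) ≈-refl x)

  lower : ∀ t x → matrix 1# 0# t 1# *ₘ matrix 1# 0# (x * t) 1# ≈ₘ matrix 1# 0# ((1# + x) * t) 1#
  lower t x = entries
    (solve 2 (λ t x → con 1 :* con 1 :+ con 0 :* (x :* t) := con 1) ≈-refl t x)
    (solve 0 (con 1 :* con 0 :+ con 0 :* con 1 := con 0) ≈-refl)
    (solve 2 (λ t x → t :* con 1 :+ con 1 :* (x :* t) := (con 1 :+ x) :* t) ≈-refl t x)
    (solve 1 (λ t → t :* con 0 :+ con 1 :* con 1 := con 1) ≈-refl t)

  scaledInverse : ∀ {s M} → s * s ≈ - 1# → M *ₘ M ≈ₘ 1ₘ →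
    ((- s) • M) *ₘ (s • M) ≈ₘ 1ₘ × (s • M) *ₘ ((- s) • M) ≈ₘ 1ₘ
  scaledInverse {s} {M} s² M² =
      combine (≈-trans (≈-sym (-‿distribˡ-* s s)) -s²)
    , combine (≈-trans (≈-sym (-‿distribʳ-* s s)) -s²)
    where
    -s² : - (s * s) ≈ 1#
    -s² = ≈-trans (-‿cong s²) (-‿involutive 1#)
    combine : ∀ {u v} → u * v ≈ 1# → (u • M) *ₘ (v • M) ≈ₘ 1ₘ
    combine {u} {v} e =
      ≈ₘ-trans (•-*ₘ u v M M) (≈ₘ-trans (•-cong e M²) (1• 1ₘ))

  module Triple (α : Carrier) (α² : α * α ≈ - 1#) where

    -α² : - α * - α ≈ - 1#
    -α² = ≈-trans (≈-sym (-‿distribˡ-* α (- α)))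
      (≈-trans (-‿cong (≈-sym (-‿distribʳ-* α α))) (≈-trans (-‿involutive _) α²))

    private
      1-1 : 1# + - 1# ≈ 0#
      1-1 = -‿inverseʳ 1#

    X Y Z : GL₂
    X = (- α) • X₀ , (- - α) • X₀ , scaledInverse -α² (A² (- 1#) 1-1 -1²)
    Y = (- α) • Y₀ , (- - α) • Y₀ , scaledInverse -α² (B² (- 1#) 1-1 -1²)
    Z = α     • Z₀ , (- α)   • Z₀ , scaledInverse α²  (C² (- 1#) 1-1 -1²)

    open Group PGL₂ using (_∙_)

    square≉0 : ∀ {s} → s * s ≈ - 1# → ¬ (s ≈ 0#)
    square≉0 s² s≈0 = -1≉0 (≈-trans (≈-sym s²) (≈-trans (*-congʳ s≈0) (zeroˡ _)))

    X∼ : proj₁ X ∼ X₀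
    X∼ = •∼ X₀ (square≉0 -α²)
    Y∼ : proj₁ Y ∼ Y₀
    Y∼ = •∼ Y₀ (square≉0 -α²)
    Z∼ : proj₁ Z ∼ Z₀
    Z∼ = •∼ Z₀ (square≉0 α²)

    module _ (2≉0 : ¬ (2# ≈ 0#)) where

      order2 : ∀ g {M} → proj₁ g ∼ M → M *ₘ M ∼ 1ₘ → ¬ (M ∼ 1ₘ) → HasOrder PGL₂ 2 g
      order2 g {M} g∼M M² M≁1 = record
        { positive = s≤s z≤n
        ; power    = ∼-trans (∼-cong g∼M (∼-trans (≈⇒∼ (*ₘ-identityʳ _)) g∼M)) M²
        ; minimal  = λ { (suc zero) _ _ e →
                           M≁1 (∼-trans (∼-sym g∼M) (∼-trans (≈⇒∼ (≈ₘ-sym (*ₘ-identityʳ _))) e))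
                       ; (suc (suc _)) _ (s≤s (s≤s ())) }
        }

      diagonal : ∀ {b c} → ¬ (matrix 1# b c (- 1#) ∼ 1ₘ)
      diagonal (s , _ , entries p _ _ q) =
        2≉0 (≈-trans (+-congˡ (≈-trans p (≈-sym q))) (-‿inverseʳ 1#))

    orderX : ¬ (2# ≈ 0#) → HasOrder PGL₂ 2 X
    orderX 2≉0 = order2 2≉0 X X∼ (≈⇒∼ (A² _ 1-1 -1²)) (diagonal 2≉0)

    orderY : ¬ (2# ≈ 0#) → HasOrder PGL₂ 2 Y
    orderY 2≉0 = order2 2≉0 Y Y∼ (≈⇒∼ (B² _ 1-1 -1²)) (diagonal 2≉0)

    orderZ : ¬ (2# ≈ 0#) → HasOrder PGL₂ 2 Z
    orderZ 2≉0 = order2 2≉0 Z Z∼ (≈⇒∼ (C² _ 1-1 -1²)) (diagonal 2≉0)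

    orderXY : ¬ (2# ≈ 0#) → HasOrder PGL₂ 2 (X ∙ Y)
    orderXY 2≉0 = order2 2≉0 (X ∙ Y)
      (∼-trans (∼-cong X∼ Y∼) (≈⇒∼ (AB _ 1-1 -1²)))
      (- 1# , -1≉0 , AB² _ 1-1 -1²) (diagonal 2≉0)

    power-YZ : ∀ m → proj₁ (_^_ PGL₂ (Y ∙ Z) m) ∼ matrix 1# (natural K m) 0# 1#
    power-YZ zero    = ∼-refl
    power-YZ (suc m) =
      ∼-trans (∼-cong (∼-trans (∼-cong Y∼ Z∼) (≈⇒∼ (BC _ 1-1 -1²))) (power-YZ m))
        (≈⇒∼ (upper (natural K m)))

    power-ZX : ∀ m → proj₁ (_^_ PGL₂ (Z ∙ X) m) ∼ matrix 1# 0# (natural K m * (- 1# * 2#)) 1#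
    power-ZX zero    = ≈⇒∼ (entries ≈-refl ≈-refl (≈-sym (zeroˡ _)) ≈-refl)
    power-ZX (suc m) =
      ∼-trans (∼-cong (∼-trans (∼-cong Z∼ X∼) (≈⇒∼ (CA _ 1-1 -1²))) (power-ZX m))
        (≈⇒∼ (lower _ (natural K m)))

    module _ {p : ℕ} (p-prime : Prime p) (p-odd : ¬ (2 ∣ p)) (cl : IsAlgebraicClosureOfGF K p) where
      open IsAlgebraicClosureOfGF cl

      p>0 : 0 < p
      p>0 = >-nonZero⁻¹ p {{prime⇒nonZero p-prime}}

      p×1 : natural K p ≈ 0#
      p×1 = Equivalence.from (characteristic p) ∣-refl

      m×1 : ∀ m → 0 < m → m < p → ¬ (natural K m ≈ 0#)
      m×1 (suc m) _ m<p e =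
        ℕ.<⇒≱ m<p (∣⇒≤ (Equivalence.to (characteristic (suc m)) e))

      p>2 : 2 < p
      p>2 = ℕ.≤∧≢⇒< (nonTrivial⇒n>1 p {{prime⇒nonTrivial p-prime}})
              (λ { refl → p-odd ∣-refl })

      2≉0 : ¬ (2# ≈ 0#)
      2≉0 e = m×1 2 (s≤s z≤n) p>2 (≈-trans (+-congˡ (+-identityʳ 1#)) e)

      orderYZ : HasOrder PGL₂ p (Y ∙ Z)
      orderYZ = record
        { positive = p>0
        ; power    = ∼-trans (power-YZ p) (≈⇒∼ (entries ≈-refl p×1 ≈-refl ≈-refl))
        ; minimal  = λ m m>0 m<p e → nontrivial m m>0 m<p (∼-trans (∼-sym (power-YZ m)) e)
        }
        where
        nontrivial : ∀ m → 0 < m → m < p → ¬ (matrix 1# (natural K m) 0# 1# ∼ 1ₘ)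
        nontrivial m m>0 m<p (s , _ , e) = m×1 m m>0 m<p (≈-trans (eq₁₂ e) (zeroʳ s))

      orderZX : HasOrder PGL₂ p (Z ∙ X)
      orderZX = record
        { positive = p>0
        ; power    = ∼-trans (power-ZX p)
                       (≈⇒∼ (entries ≈-refl ≈-refl (≈-trans (*-congʳ p×1) (zeroˡ _)) ≈-refl))
        ; minimal  = λ m m>0 m<p e → nontrivial m m>0 m<p (∼-trans (∼-sym (power-ZX m)) e)
        }
        where
        nontrivial : ∀ m → 0 < m → m < p →
                     ¬ (matrix 1# 0# (natural K m * (- 1# * 2#)) 1# ∼ 1ₘ)
        nontrivial m m>0 m<p (s , _ , e) = m×1 m m>0 m<p
          (cancelʳ (λ -2≈0 → -1≉0 (cancelʳ 2≉0 -2≈0)) (≈-trans (eq₂₁ e) (zeroʳ s)))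

      regularMap : RegularMap (c ⊔ ℓ) (c ⊔ ℓ) p p
      regularMap = generatedMap PGL₂ X Y Z
        (orderX 2≉0) (orderY 2≉0) (orderZ 2≉0) (orderXY 2≉0) orderYZ orderZX

{-# OPTIONS --safe #-}

-- In PGL(2,K) the matrix W = (0 1; 2 0) satisfies W² = 2 ∼ 1, and it conjugates
-- Z to Z and X to Y up to the scalar -1.  So conjugation by W is an involutory
-- automorphism which permutes the generators as required, and it therefore
-- preserves the subgroup which they generate.
module Submission where

open import Defs
open import Level using (Level)
open import Algebra.Bundles using (Group)
import Algebra.Properties.Group
import Algebra.Solver.Ring.NaturalCoefficients.Default
open import Data.Fin.Base using (zero; suc)
open import Data.Nat.Base using (ℕ)
open import Data.Nat.Divisibility using (_∣_)
open import Data.Nat.Primality using (Prime; prime⇒nonZero)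
open import Data.Product.Base using (_,_; proj₁; proj₂)
open import Relation.Nullary using (¬_)
import Relation.Binary.Reasoning.Setoid

module InvolutoryConjugation {c ℓ} (G : Group c ℓ) (w : Group.Carrier G)
  (w² : Group._≈_ G (Group._∙_ G w w) (Group.ε G)) where
  open Group G
  open Algebra.Properties.Group G using (inverseˡ-unique)
  open Relation.Binary.Reasoning.Setoid setoid

  -- By `w²` the element `w` is its own inverse, so this is conjugation by `w` with no `w ⁻¹` in it.
  conj : Carrier → Carrier
  conj g = w ∙ g ∙ w

  conj-cong : ∀ {g h} → g ≈ h → conj g ≈ conj h
  conj-cong e = ∙-congʳ (∙-congˡ e)

  w-cancelˡ : ∀ g → w ∙ (w ∙ g) ≈ g
  w-cancelˡ g = trans (sym (assoc w w g)) (trans (∙-congʳ w²) (identityˡ g))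

  w-cancelʳ : ∀ g → g ∙ w ∙ w ≈ g
  w-cancelʳ g = trans (assoc g w w) (trans (∙-congˡ w²) (identityʳ g))

  conj-involutive : ∀ g → conj (conj g) ≈ g
  conj-involutive g = begin
    w ∙ (w ∙ g ∙ w) ∙ w ≈⟨ assoc w (w ∙ g ∙ w) w ⟩
    w ∙ (w ∙ g ∙ w ∙ w) ≈⟨ ∙-congˡ (w-cancelʳ (w ∙ g)) ⟩
    w ∙ (w ∙ g)         ≈⟨ w-cancelˡ g ⟩
    g                   ∎

  conj-injective : ∀ {g h} → conj g ≈ conj h → g ≈ h
  conj-injective {g} {h} e =
    trans (sym (conj-involutive g)) (trans (conj-cong e) (conj-involutive h))

  conj-∙ : ∀ g h → conj (g ∙ h) ≈ conj g ∙ conj h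
  conj-∙ g h = begin
    w ∙ (g ∙ h) ∙ w           ≈⟨ ∙-congʳ (assoc w g h) ⟨
    w ∙ g ∙ h ∙ w             ≈⟨ assoc (w ∙ g) h w ⟩
    -- The trivial factor `w ∙ w` is inserted between `g` and `h`.
    w ∙ g ∙ (h ∙ w)           ≈⟨ ∙-congˡ (w-cancelˡ (h ∙ w)) ⟨
    w ∙ g ∙ (w ∙ (w ∙ (h ∙ w))) ≈⟨ assoc (w ∙ g) w (w ∙ (h ∙ w)) ⟨
    conj g ∙ (w ∙ (h ∙ w))    ≈⟨ ∙-congˡ (assoc w h w) ⟨
    conj g ∙ conj h           ∎

  conj-ε : conj ε ≈ ε
  conj-ε = trans (∙-congʳ (identityʳ w)) w²

  conj-⁻¹ : ∀ g → conj (g ⁻¹) ≈ conj g ⁻¹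
  conj-⁻¹ g = inverseˡ-unique (conj (g ⁻¹)) (conj g) (begin
    conj (g ⁻¹) ∙ conj g ≈⟨ conj-∙ (g ⁻¹) g ⟨
    conj (g ⁻¹ ∙ g)      ≈⟨ conj-cong (inverseˡ g) ⟩
    conj ε               ≈⟨ conj-ε ⟩
    ε                    ∎)

  -- Reduces a conjugation claim to an intertwining relation, where each side is a single matrix
  -- product.
  conj-swap : ∀ {g h} → w ∙ g ≈ h ∙ w → conj g ≈ h
  conj-swap {g} {h} e = trans (∙-congʳ e) (w-cancelʳ h)

  -- Conjugation is a homomorphism, so only the generators need checking; this restricts it to the
  -- generated subgroup.
  conj-preserves-Generated : ∀ {I : Set} {S : I → Carrier} →
    (∀ i → Generated G S (conj (S i))) → ∀ {g} → Generated G S g → Generated G S (conj g)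
  conj-preserves-Generated f (gen i)     = f i
  conj-preserves-Generated f gen-ε       = gen-≈ (sym conj-ε) gen-ε
  conj-preserves-Generated f (gen-∙ s t) = gen-≈ (sym (conj-∙ _ _))
    (gen-∙ (conj-preserves-Generated f s) (conj-preserves-Generated f t))
  conj-preserves-Generated f (gen-⁻¹ s)  =
    gen-≈ (sym (conj-⁻¹ _)) (gen-⁻¹ (conj-preserves-Generated f s))
  conj-preserves-Generated f (gen-≈ e s) =
    gen-≈ (conj-cong e) (conj-preserves-Generated f s)

  generatedMap-selfDual : ∀ {k l X Y Z} oX oY oZ oXY oYZ oZX →
    conj X ≈ Y → conj Z ≈ Z → SelfDual (generatedMap G {k} {l} X Y Z oX oY oZ oXY oYZ oZX)
  generatedMap-selfDual {X = X} {Y} {Z} _ _ _ _ _ _ X↦Y Z↦Z = record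
    { φ              = λ (g , s) → conj g , conj-preserves-Generated generators s
    ; isAutomorphism = record
      { isGroupMonomorphism = record
        { isGroupHomomorphism = record
          { isMonoidHomomorphism = record
            { isMagmaHomomorphism = record
              { isRelHomomorphism = record { cong = conj-cong }
              ; homo = λ (g , _) (h , _) → conj-∙ g h
              }
            ; ε-homo = conj-ε
            }
          ; ⁻¹-homo = λ (g , _) → conj-⁻¹ g
          }
        ; injective = conj-injective
        }
      -- An involution is its own inverse, so `conj g` is a preimage of `g`.
      ; surjective = λ (g , s) →
          (conj g , conj-preserves-Generated generators s) ,
          λ e → trans (conj-cong e) (conj-involutive g)
      }
    ; involutory     = λ (g , _) → conj-involutive g
    ; fixes-Z        = Z↦Z
    ; X↦Y            = X↦Y
    ; Y↦X            = Y↦X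
    }
    where
    Y↦X : conj Y ≈ X
    Y↦X = trans (conj-cong (sym X↦Y)) (conj-involutive X)

    generators : ∀ i → Generated G (triple G X Y Z) (conj (triple G X Y Z i))
    generators zero             = gen-≈ (sym X↦Y) (gen (suc zero))
    generators (suc zero)       = gen-≈ (sym Y↦X) (gen zero)
    generators (suc (suc zero)) = gen-≈ (sym Z↦Z) (gen (suc (suc zero)))

module Duality {c ℓ} (K : Field c ℓ) where
  open Field K hiding (zero)
  open Projective K
  open Algebra.Solver.Ring.NaturalCoefficients.Default commutativeSemiring
    using (solve; _:=_; _:+_; _:*_; con)

  -- As a Möbius map this is z ↦ 1/(2z). It must swap the fixed point 0 of ZX with the fixed point ∞
  -- of YZ, hence is antidiagonal; comparing the entries 2 of `X₀` and -1 of `Y₀` fixes the ratio of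
  -- its entries.
  W₀ : Matrix
  W₀ = matrix 0# 1# (2# K) 0#

  -- n stands for - 1#, which the semiring solver cannot handle.
  module _ (n : Carrier) (n² : n * n ≈ 1#) where

    private
      -- The solver treats `n` as a free variable; this applies `n²` to what it leaves.
      absorb : ∀ {x} y → x ≈ (n * n) * y → y ≈ x
      absorb y e = sym (trans e (trans (*-congʳ n²) (*-identityˡ y)))

    W₀X₀ : W₀ *ₘ matrix 1# 0# (2# K) n ≈ₘ n • (matrix 1# n 0# n *ₘ W₀)
    W₀X₀ = entries
      (trans (solve 0 (con 0 :* con 1 :+ con 1 :* (con 1 :+ con 1) := con 1 :+ con 1) refl)
        (absorb (2# K) (solve 1 (λ n → n :* (con 1 :* con 0 :+ n :* (con 1 :+ con 1))
          := (n :* n) :* (con 1 :+ con 1)) refl n)))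
      (solve 1 (λ n → con 0 :* con 0 :+ con 1 :* n
        := n :* (con 1 :* con 1 :+ n :* con 0)) refl n)
      (trans (solve 0 ((con 1 :+ con 1) :* con 1 :+ con 0 :* (con 1 :+ con 1)
          := con 1 :+ con 1) refl)
        (absorb (2# K) (solve 1 (λ n → n :* (con 0 :* con 0 :+ n :* (con 1 :+ con 1))
          := (n :* n) :* (con 1 :+ con 1)) refl n)))
      (solve 1 (λ n → (con 1 :+ con 1) :* con 0 :+ con 0 :* n
        := n :* (con 0 :* con 1 :+ n :* con 0)) refl n)

    -- At n = -1 an antidiagonal matrix anticommutes with diag(1, -1), so the two commute
    -- projectively.
    W₀Z₀ : W₀ *ₘ matrix 1# 0# 0# n ≈ₘ n • (matrix 1# 0# 0# n *ₘ W₀)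
    W₀Z₀ = entries
      (solve 1 (λ n → con 0 :* con 1 :+ con 1 :* con 0
        := n :* (con 1 :* con 0 :+ con 0 :* (con 1 :+ con 1))) refl n)
      (solve 1 (λ n → con 0 :* con 0 :+ con 1 :* n
        := n :* (con 1 :* con 1 :+ con 0 :* con 0)) refl n)
      (trans (solve 0 ((con 1 :+ con 1) :* con 1 :+ con 0 :* con 0 := con 1 :+ con 1) refl)
        (absorb (2# K) (solve 1 (λ n → n :* (con 0 :* con 0 :+ n :* (con 1 :+ con 1))
          := (n :* n) :* (con 1 :+ con 1)) refl n)))
      (solve 1 (λ n → (con 1 :+ con 1) :* con 0 :+ con 0 :* n
        := n :* (con 0 :* con 1 :+ n :* con 0)) refl n)

  W₀² : W₀ *ₘ W₀ ≈ₘ 2# K • 1ₘ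
  W₀² = entries
    (solve 0 (con 0 :* con 0 :+ con 1 :* (con 1 :+ con 1) := (con 1 :+ con 1) :* con 1) refl)
    (solve 0 (con 0 :* con 1 :+ con 1 :* con 0 := (con 1 :+ con 1) :* con 0) refl)
    (solve 0 ((con 1 :+ con 1) :* con 0 :+ con 0 :* (con 1 :+ con 1)
      := (con 1 :+ con 1) :* con 0) refl)
    (solve 0 ((con 1 :+ con 1) :* con 1 :+ con 0 :* con 0 := (con 1 :+ con 1) :* con 1) refl)

  module _ (2≉0 : ¬ (2# K ≈ 0#)) where

    -- Since `W₀²` is the scalar 2, the inverse matrix is `W₀` scaled by `h` = 1/2, which exists as
    -- 2 ≠ 0.
    W : GL₂
    W = W₀ , h • W₀ , left , right
      where
      h = proj₁ (reciprocal 2≉0)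

      h2≈1 : h * 2# K ≈ 1#
      h2≈1 = proj₂ (reciprocal 2≉0)

      scaled : ∀ {s t} → (s * t) * 2# K ≈ 1# → (s • W₀) *ₘ (t • W₀) ≈ₘ 1ₘ
      scaled {s} {t} e = ≈ₘ-trans (•-*ₘ s t W₀ W₀) (≈ₘ-trans (•-cong refl W₀²)
        (≈ₘ-trans (•-• (s * t) (2# K) 1ₘ) (≈ₘ-trans (•-cong e ≈ₘ-refl) (1• 1ₘ))))

      left : (h • W₀) *ₘ W₀ ≈ₘ 1ₘ
      left = ≈ₘ-trans (*ₘ-cong ≈ₘ-refl (≈ₘ-sym (1• W₀)))
        (scaled (trans (*-congʳ (*-identityʳ h)) h2≈1))

      right : W₀ *ₘ (h • W₀) ≈ₘ 1ₘ
      right = ≈ₘ-trans (*ₘ-cong (≈ₘ-sym (1• W₀)) ≈ₘ-refl)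
        (scaled (trans (*-congʳ (*-identityˡ h)) h2≈1))

    open Group PGL₂ using (_∙_; ε) renaming (_≈_ to _≈ₚ_)

    W² : W ∙ W ≈ₚ ε
    W² = 2# K , 2≉0 , W₀²

    open InvolutoryConjugation PGL₂ W W² public

    module _ (α : Carrier) (α² : α * α ≈ - 1#) where
      open Triple K α α² using (X; Y; Z; X∼; Y∼; Z∼)

      conj-X : conj X ≈ₚ Y
      -- The scalars -α are dropped projectively, leaving `X₀` and `Y₀`, which `W₀` intertwines up
      -- to the factor -1.
      conj-X = conj-swap {X} {Y} (∼-trans (∼-cong ∼-refl X∼)
        (∼-trans (- 1# , -1≉0 K , W₀X₀ (- 1#) (-1² K)) (∼-cong (∼-sym Y∼) ∼-refl)))

      conj-Z : conj Z ≈ₚ Z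
      conj-Z = conj-swap {Z} {Z} (∼-trans (∼-cong ∼-refl Z∼)
        (∼-trans (- 1# , -1≉0 K , W₀Z₀ (- 1#) (-1² K)) (∼-cong (∼-sym Z∼) ∼-refl)))

proposition3p1 : {c ℓ : Level} (p : ℕ) (p-prime : Prime p) (p-odd : ¬ (2 ∣ p)) →
    Hyperbolic p p {{prime⇒nonZero p-prime}} {{prime⇒nonZero p-prime}} →
    (K : Field c ℓ) (cl : IsAlgebraicClosureOfGF K p) →
    let open Field K in
    (α : Carrier) (α² : α * α ≈ - 1#) →
    SelfDual (Triple.regularMap K α α² p-prime p-odd cl)
-- The proof of 2 ≠ 0 is repeated rather than named: the arguments then agree
-- syntactically with those of regularMap, and the order proofs are not unfolded.
proposition3p1 p p-prime p-odd _ K cl α α² =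
  generatedMap-selfDual (2≉0 p-prime p-odd cl) {p} {p} {X} {Y} {Z}
    (orderX (2≉0 p-prime p-odd cl)) (orderY (2≉0 p-prime p-odd cl))
    (orderZ (2≉0 p-prime p-odd cl)) (orderXY (2≉0 p-prime p-odd cl))
    (orderYZ p-prime p-odd cl) (orderZX p-prime p-odd cl)
    (conj-X (2≉0 p-prime p-odd cl) α α²) (conj-Z (2≉0 p-prime p-odd cl) α α²)
  where
  open Duality K
  open Triple K α α²
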